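{- It is not true that for all integers $n\ge 2a\ge 2b\ge 4$, all non-trivial cross-intersecting families $\mathcal A\subset\binom{[n]}{a}$, $\mathcal B\subset\binom{[n]}{b}$ satisfy $|\mathcal A||\mathcal B|\le|\mathcal A_0||\mathcal B_0|$. More precisely, for $a=9$, $b=3$, $n=18$, the families $$\mathcal C_a=\Big\{C\in\tbinom{[n]}{a}:\{1,2\}\subset C\Big\}\cup\{[3,a+2]\},$$ $$\mathcal C_b=\Big\{C\in\tbinom{[n]}{b}:\{i,j\}\subset C\text{ for some } i\in\{1,2\},\ j\in[3,a+2]\Big\}$$ are non-trivial cross-intersecting and satisfy $|\mathcal C_a||\mathcal C_b|>|\mathcal A_0||\mathcal B_0|$.
   Context: $[n]=\{1,\dots,n\}$, $[p,q]=\{p,p+1,\dots,q\}$, and $\binom{X}{k}$ is the collection of $k$-subsets of $X$. A family is a star if all members contain a common element. Families are non-trivial cross-intersecting if every member of one meets every member of the other and neither family is a star. For integers $n\ge 2a\ge2b\ge4$, fix $A_0\in\binom{[2,n]}{a}$ and $B_0\in\binom{[2,n]}{b}$ with $A_0\cap B_0\ne\emptyset$ and put $\mathcal A_0=\{A_0\}\cup\{A\in\binom{[n]}{a}:1\in A,\ A\cap B_0\neq\emptyset\}$ and $\mathcal B_0=\{B_0\}\cup\{B\in\binom{[n]}{b}:1\in B,\ B\cap A_0\ne\emptyset\}$ (the sizes of $\mathcal A_0,\mathcal B_0$ do not depend on the choice of $A_0,B_0$). -}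

module Defs where

open import Data.Bool using (_∧_)
import Data.Bool.Properties as Bool
open import Data.Fin using (Fin; toℕ)
open import Data.Fin.Properties using (any?)
open import Data.Fin.Subset
  using (Subset; inside; outside; _∈_; _⊆_; _∩_; _∪_; ⁅_⁆; Nonempty; ∣_∣)
open import Data.Fin.Subset.Properties using (_∈?_; _⊆?_; nonempty?)
open import Data.List using (List; length; filter; map; _++_)
import Data.List as List
open import Data.Nat using (ℕ; zero; suc; _+_; _≟_; _≤?_)
open import Data.Product using (_×_; ∃; ∃-syntax)
open import Data.Sum using (_⊎_)
open import Data.Vec using ([]; _∷_; tabulate)
open import Data.Vec.Properties using (≡-dec)
open import Level using (0ℓ)
open import Relation.Binary.PropositionalEquality using (_≡_)
open import Relation.Nullary using (¬_; does; _×-dec_; _⊎-dec_)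
open import Relation.Unary using (Pred; Decidable)

-- [n] = {1,…,n} is modelled by Fin n, the index i standing for the integer
-- label i.
label : ∀ {n} → Fin n → ℕ
label i = suc (toℕ i)

-- The part of {p, p+1, …, q} that lies in [n].
[_⋯_] : ∀ {n} → ℕ → ℕ → Subset n
[ p ⋯ q ] = tabulate λ i → does (p ≤? label i) ∧ does (label i ≤? q)

-- Families are decidable predicates, so that every family has a cardinality.
record Family (n : ℕ) : Set₁ where
  field
    Member  : Pred (Subset n) 0ℓ
    member? : Decidable Member

open Family public

infix 4 _∈ᶠ_

_∈ᶠ_ : ∀ {n} → Subset n → Family n → Set
A ∈ᶠ 𝒜 = Member 𝒜 A

-- Every subset of [n], each listed exactly once.
subsets : ∀ n → List (Subset n)
subsets zero    = List.[ [] ]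
subsets (suc n) = map (outside ∷_) (subsets n) ++ map (inside ∷_) (subsets n)

card : ∀ {n} → Family n → ℕ
card {n} 𝒜 = length (filter (member? 𝒜) (subsets n))

-- 𝒜 ⊂ binom([n], k)
Uniform : ∀ {n} → ℕ → Family n → Set
Uniform k 𝒜 = ∀ {A} → A ∈ᶠ 𝒜 → ∣ A ∣ ≡ k

Star : ∀ {n} → Family n → Set
Star 𝒜 = ∃[ x ] (∀ {A} → A ∈ᶠ 𝒜 → x ∈ A)

CrossIntersecting : ∀ {n} → Family n → Family n → Set
CrossIntersecting 𝒜 ℬ = ∀ {A B} → A ∈ᶠ 𝒜 → B ∈ᶠ ℬ → Nonempty (A ∩ B)

NonTrivialCrossIntersecting : ∀ {n} → Family n → Family n → Set
NonTrivialCrossIntersecting 𝒜 ℬ = CrossIntersecting 𝒜 ℬ × ¬ Star 𝒜 × ¬ Star ℬ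

-- The conditions on the fixed sets: A₀ ∈ binom([2,n], a), B₀ ∈ binom([2,n], b)
-- and A₀ ∩ B₀ ≠ ∅.
record BasePair (n a b : ℕ) (A₀ B₀ : Subset n) : Set where
  field
    A₀⊆[2,n]  : A₀ ⊆ [ 2 ⋯ n ]
    ∣A₀∣≡a    : ∣ A₀ ∣ ≡ a
    B₀⊆[2,n]  : B₀ ⊆ [ 2 ⋯ n ]
    ∣B₀∣≡b    : ∣ B₀ ∣ ≡ b
    A₀∩B₀≢∅   : Nonempty (A₀ ∩ B₀)

-- {S} ∪ {A ∈ binom([n], k) : 1 ∈ A, A ∩ T ≠ ∅}.  Hence 𝒜₀ = base a A₀ B₀ and
-- ℬ₀ = base b B₀ A₀.
base : ∀ {n} → ℕ → Subset n → Subset n → Family n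
base k S T .Member A =
  A ≡ S ⊎ (∣ A ∣ ≡ k × (∃[ i ] (label i ≡ 1 × i ∈ A)) × Nonempty (A ∩ T))
base k S T .member? A =
  ≡-dec Bool._≟_ A S
    ⊎-dec (∣ A ∣ ≟ k ×-dec any? (λ i → label i ≟ 1 ×-dec i ∈? A)
           ×-dec nonempty? (A ∩ T))

𝒞ₐ : ∀ n → ℕ → Family n
𝒞ₐ n a .Member C = (∣ C ∣ ≡ a × [ 1 ⋯ 2 ] ⊆ C) ⊎ C ≡ [ 3 ⋯ a + 2 ]
𝒞ₐ n a .member? C =
  (∣ C ∣ ≟ a ×-dec [ 1 ⋯ 2 ] ⊆? C) ⊎-dec ≡-dec Bool._≟_ C [ 3 ⋯ a + 2 ]

𝒞ᵇ : ∀ n → ℕ → ℕ → Family n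
𝒞ᵇ n a b .Member C =
  ∣ C ∣ ≡ b ×
  (∃[ i ] ∃[ j ] (i ∈ [ 1 ⋯ 2 ] × j ∈ [ 3 ⋯ a + 2 ] × ⁅ i ⁆ ∪ ⁅ j ⁆ ⊆ C))
𝒞ᵇ n a b .member? C =
  ∣ C ∣ ≟ b ×-dec
  any? λ i → any? λ j →
    i ∈? [ 1 ⋯ 2 ] ×-dec j ∈? [ 3 ⋯ a + 2 ] ×-dec (⁅ i ⁆ ∪ ⁅ j ⁆) ⊆? C

{-# OPTIONS --safe #-}
module Submission where

-- All four families are, up to one extra set, of the form "k-sets meeting both
-- X and Y": X = {1} and Y = B₀ (resp. A₀) for the base families, X = {1} and
-- Y = {2} for 𝒞ₐ, X = [1,2] and Y = [3,a+2] for 𝒞ᵇ.  By inclusion–exclusion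
-- such a family has
--   C(n,k) − C(n−|X|,k) − C(n−|Y|,k) + C(n−|X∪Y|,k)
-- members, which for (n,a,b) = (18,9,3) gives
--   |𝒞ₐ||𝒞ᵇ| = 11441 · 207 = 2368287 > 2322572 = 21308 · 109 = |𝒜₀||ℬ₀|.

import Data.Bool.Properties as Bool
open import Data.Fin using (zero; suc)
open import Data.Fin.Subset
  using (Subset; inside; outside; _∈_; _⊆_; _∩_; _∪_; ∁; ⁅_⁆; ⊥; ⊤; Nonempty; Empty; ∣_∣)
open import Data.Fin.Subset.Properties
  using ( _∈?_; _⊆?_; nonempty?; drop-∷-⊆; out⊆; in⊆in; ∣⊤∣≡n; ⊆⊤; ⊆-antisym; ∣⁅x⁆∣≡1
        ; x∈⁅x⁆; x∈⁅y⁆⇒x≡y; p⊂q⇒∣p∣<∣q∣; x∈∁p⇒x∉p; x∉p⇒x∈∁p; ∣∁p∣≡n∸∣p∣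
        ; x∈p∩q⁺; x∈p∩q⁻; x∈p∪q⁻; p⊆p∪q; q⊆p∪q; ∪-identityˡ; ∩-comm)
open import Data.List using ([]; _∷_; length; filter; map; _++_)
open import Data.List.Properties using (filter-++; filter-≐; filter-none; length-++)
open import Data.List.Relation.Unary.All using (universal)
open import Data.Nat
  using (ℕ; zero; suc; _+_; _∸_; _*_; _≤_; _≥_; _<_; _>_; z≤n; s≤s; _≟_; _≤?_; _<?_)
open import Data.Nat.Combinatorics using (_C_; nCn≡1; nCk+nC[k+1]≡[n+1]C[k+1])
open import Data.Nat.Properties
  using (+-comm; +-identityʳ; +-suc; m+n∸n≡m; suc-injective; <⇒≢; <⇒≱)
open import Data.Nat.Solver using (module +-*-Solver)
open import Data.Product using (_×_; _,_; proj₁)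
open import Data.Sum using (inj₁; inj₂; [_,_])
import Data.Sum as Sum
open import Data.Vec using ([]; _∷_; here; there)
open import Data.Vec.Properties using (≡-dec; lookup∘tabulate; []=⇒lookup)
open import Function using (_∘_; id)
open import Level using (0ℓ)
open import Relation.Binary.PropositionalEquality
  using (_≡_; refl; sym; trans; cong; cong₂; subst; subst₂; module ≡-Reasoning)
open import Relation.Nullary using (¬_; yes; no; contradiction)
open import Relation.Nullary.Decidable using (from-yes; from-no)
open import Relation.Unary using (Pred; Decidable; _≐_)
import Relation.Unary as Unary
open import Relation.Unary.Properties using (_∪?_; _∩?_; ∁?)
open import Defs

-- Counting the subsets of [n] that satisfy a decidable predicate.

length-filter-map : ∀ {A B : Set} {P : Pred B 0ℓ} (P? : Decidable P) (f : A → B) xs →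
                    length (filter P? (map f xs)) ≡ length (filter (P? ∘ f) xs)
length-filter-map P? f [] = refl
length-filter-map P? f (x ∷ xs) with P? (f x)
... | yes _ = cong suc (length-filter-map P? f xs)
... | no  _ = length-filter-map P? f xs

length-filter-∪ : ∀ {A : Set} {P Q : Pred A 0ℓ} (P? : Decidable P) (Q? : Decidable Q) →
                  (∀ {x} → P x → ¬ Q x) → ∀ xs →
                  length (filter (P? ∪? Q?) xs) ≡
                  length (filter P? xs) + length (filter Q? xs)
length-filter-∪ P? Q? P⇒¬Q [] = refl
length-filter-∪ P? Q? P⇒¬Q (x ∷ xs) with P? x | Q? x
... | yes p | yes q = contradiction q (P⇒¬Q p)
... | yes _ | no  _ = cong suc (length-filter-∪ P? Q? P⇒¬Q xs)
... | no  _ | yes _ = trans (cong suc (length-filter-∪ P? Q? P⇒¬Q xs)) (sym (+-suc _ _))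
... | no  _ | no  _ = length-filter-∪ P? Q? P⇒¬Q xs

count : ∀ {n} {P : Pred (Subset n) 0ℓ} → Decidable P → ℕ
count {n} P? = length (filter P? (subsets n))

module _ {n} {P Q : Pred (Subset n) 0ℓ} (P? : Decidable P) (Q? : Decidable Q) where

  count-≐ : P ≐ Q → count P? ≡ count Q?
  count-≐ P≐Q = cong length (filter-≐ P? Q? P≐Q (subsets n))

  count-∪ : (∀ {A} → P A → ¬ Q A) → count (P? ∪? Q?) ≡ count P? + count Q?
  count-∪ P⇒¬Q = length-filter-∪ P? Q? P⇒¬Q (subsets n)

count-split : ∀ {n} {P Q : Pred (Subset n) 0ℓ} (P? : Decidable P) (Q? : Decidable Q) →
              count P? ≡ count (P? ∩? Q?) + count (P? ∩? ∁? Q?)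
count-split {P = P} {Q} P? Q? =
  trans (count-≐ P? ((P? ∩? Q?) ∪? (P? ∩? ∁? Q?)) (split , [ proj₁ , proj₁ ]))
        (count-∪ (P? ∩? Q?) (P? ∩? ∁? Q?) λ (_ , q) (_ , ¬q) → ¬q q)
  where
  split : P Unary.⊆ (P Unary.∩ Q) Unary.∪ (P Unary.∩ Unary.∁ Q)
  split {A} p with Q? A
  ... | yes q = inj₁ (p , q)
  ... | no ¬q = inj₂ (p , ¬q)

count-none : ∀ {n} {P : Pred (Subset n) 0ℓ} (P? : Decidable P) →
             (∀ A → ¬ P A) → count P? ≡ 0
count-none {n} P? ¬P = cong length (filter-none P? (universal ¬P (subsets n)))

-- Mirrors the recursion of `subsets`, so that later inductions on the ground set work with `count`
-- alone and no longer with lists.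
count-∷ : ∀ {n} {P : Pred (Subset (suc n)) 0ℓ} (P? : Decidable P) →
          count P? ≡ count (P? ∘ (outside ∷_)) + count (P? ∘ (inside ∷_))
count-∷ {n} P? = begin
  length (filter P? (outs ++ ins))                  ≡⟨ cong length (filter-++ P? outs ins) ⟩
  length (filter P? outs ++ filter P? ins)          ≡⟨ length-++ (filter P? outs) ⟩
  length (filter P? outs) + length (filter P? ins)  ≡⟨ cong₂ _+_ (length-filter-map P? _ (subsets n))
                                                                 (length-filter-map P? _ (subsets n)) ⟩
  count (P? ∘ (outside ∷_)) + count (P? ∘ (inside ∷_)) ∎
  where
  open ≡-Reasoning
  outs = map (outside ∷_) (subsets n)
  ins  = map (inside ∷_) (subsets n)

-- Sets of size k inside, equal to, or disjoint from a given set.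

size? : ∀ {n} k → Decidable {A = Subset n} (λ A → ∣ A ∣ ≡ k)
size? k A = ∣ A ∣ ≟ k

within? : ∀ {n} (S : Subset n) → Decidable (_⊆ S)
within? S A = A ⊆? S

meets? : ∀ {n} (X : Subset n) → Decidable (λ A → Nonempty (A ∩ X))
meets? X A = nonempty? (A ∩ X)

-- Pascal's rule, by recursion on S. A head element outside S can never be chosen; a head element
-- inside S splits the count according to whether it is chosen, and choosing it lowers the remaining
-- size by one.
count-⊆ : ∀ {n} k (S : Subset n) → count (size? k ∩? within? S) ≡ ∣ S ∣ C k
count-⊆ zero    [] = refl
count-⊆ (suc k) [] = refl
count-⊆ k (outside ∷ S) = begin
  count P?                                             ≡⟨ count-∷ P? ⟩
  count (P? ∘ (outside ∷_)) + count (P? ∘ (inside ∷_)) ≡⟨ cong₂ _+_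
      (count-≐ _ (size? k ∩? within? S)
        ((λ (e , i) → e , drop-∷-⊆ i) , (λ (e , i) → e , out⊆ i)))
      (count-none (P? ∘ (inside ∷_)) λ _ (_ , i) → contradiction (i here) λ ()) ⟩
  count (size? k ∩? within? S) + 0                     ≡⟨ +-identityʳ _ ⟩
  count (size? k ∩? within? S)                         ≡⟨ count-⊆ k S ⟩
  ∣ S ∣ C k                                            ∎
  where
  open ≡-Reasoning
  P? = size? k ∩? within? (outside ∷ S)
-- A set containing the head has positive size, so for k = 0 only the sets avoiding it remain.
count-⊆ zero (inside ∷ S) =
  trans (count-∷ P?)
    (cong₂ _+_
      (trans (count-≐ _ (size? 0 ∩? within? S)
               ((λ (e , i) → e , drop-∷-⊆ i) , (λ (e , i) → e , out⊆ i)))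
             (count-⊆ 0 S))
      (count-none (P? ∘ (inside ∷_)) λ _ ()))
  where P? = size? 0 ∩? within? (inside ∷ S)
count-⊆ (suc k) (inside ∷ S) = begin
  count P?                                             ≡⟨ count-∷ P? ⟩
  count (P? ∘ (outside ∷_)) + count (P? ∘ (inside ∷_)) ≡⟨ cong₂ _+_
      (count-≐ _ (size? (suc k) ∩? within? S)
        ((λ (e , i) → e , drop-∷-⊆ i) , (λ (e , i) → e , out⊆ i)))
      (count-≐ _ (size? k ∩? within? S)
        ((λ (e , i) → suc-injective e , drop-∷-⊆ i) , (λ (e , i) → cong suc e , in⊆in i))) ⟩
  count (size? (suc k) ∩? within? S) + count (size? k ∩? within? S)
                                                       ≡⟨ cong₂ _+_ (count-⊆ (suc k) S) (count-⊆ k S) ⟩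
  ∣ S ∣ C suc k + ∣ S ∣ C k                            ≡⟨ +-comm (∣ S ∣ C suc k) _ ⟩
  ∣ S ∣ C k + ∣ S ∣ C suc k                            ≡⟨ nCk+nC[k+1]≡[n+1]C[k+1] ∣ S ∣ k ⟩
  suc ∣ S ∣ C suc k                                    ∎
  where
  open ≡-Reasoning
  P? = size? (suc k) ∩? within? (inside ∷ S)

count-size : ∀ {n} k → count (size? {n} k) ≡ n C k
count-size {n} k = begin
  count (size? {n} k)               ≡⟨ count-≐ (size? k) (size? {n} k ∩? within? ⊤) ((λ e → e , ⊆⊤) , proj₁) ⟩
  count (size? {n} k ∩? within? ⊤)  ≡⟨ count-⊆ {n} k ⊤ ⟩
  ∣ ⊤ {n} ∣ C k                     ≡⟨ cong (_C k) (∣⊤∣≡n n) ⟩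
  n C k                             ∎
  where open ≡-Reasoning

⊆∧∣∣≡⇒≡ : ∀ {n} {A B : Subset n} → A ⊆ B → ∣ A ∣ ≡ ∣ B ∣ → A ≡ B
⊆∧∣∣≡⇒≡ {A = A} A⊆B ∣A∣≡∣B∣ = ⊆-antisym A⊆B B⊆A
  where
  B⊆A : _ ⊆ A
  B⊆A {x} x∈B with x ∈? A
  ... | yes x∈A = x∈A
  ... | no  x∉A = contradiction ∣A∣≡∣B∣ (<⇒≢ (p⊂q⇒∣p∣<∣q∣ (A⊆B , x , x∈B , x∉A)))

is? : ∀ {n} (S : Subset n) → Decidable (_≡ S)
is? S A = ≡-dec Bool._≟_ A S

-- S is its own only subset of full size, so this is `count-⊆` at k = |S|.
count-≡ : ∀ {n} (S : Subset n) → count (is? S) ≡ 1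
count-≡ S = begin
  count (is? S)                        ≡⟨ count-≐ (is? S) (size? ∣ S ∣ ∩? within? S)
                                            ( (λ { refl → refl , id })
                                            , (λ (e , i) → ⊆∧∣∣≡⇒≡ i e)) ⟩
  count (size? ∣ S ∣ ∩? within? S)     ≡⟨ count-⊆ ∣ S ∣ S ⟩
  ∣ S ∣ C ∣ S ∣                        ≡⟨ nCn≡1 ∣ S ∣ ⟩
  1                                    ∎
  where open ≡-Reasoning

Empty-∩⇒⊆∁ : ∀ {n} {A X : Subset n} → Empty (A ∩ X) → A ⊆ ∁ X
Empty-∩⇒⊆∁ A∩X≡∅ x∈A = x∉p⇒x∈∁p λ x∈X → A∩X≡∅ (_ , x∈p∩q⁺ (x∈A , x∈X))

⊆∁⇒Empty-∩ : ∀ {n} {A X : Subset n} → A ⊆ ∁ X → Empty (A ∩ X)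
⊆∁⇒Empty-∩ {A = A} {X} A⊆∁X (_ , x∈A∩X) with x∈p∩q⁻ A X x∈A∩X
... | x∈A , x∈X = x∈∁p⇒x∉p (A⊆∁X x∈A) x∈X

-- Avoiding X means lying inside its complement, which reduces the count to `count-⊆`.
count-disjoint : ∀ {n} k (X : Subset n) →
                 count (size? k ∩? ∁? (meets? X)) ≡ (n ∸ ∣ X ∣) C k
count-disjoint {n} k X = begin
  count (size? k ∩? ∁? (meets? X))  ≡⟨ count-≐ _ (size? k ∩? within? (∁ X))
                                         ( (λ (e , d) → e , Empty-∩⇒⊆∁ d)
                                         , (λ (e , i) → e , ⊆∁⇒Empty-∩ i)) ⟩
  count (size? k ∩? within? (∁ X))  ≡⟨ count-⊆ k (∁ X) ⟩
  ∣ ∁ X ∣ C k                       ≡⟨ cong (_C k) (∣∁p∣≡n∸∣p∣ X) ⟩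
  (n ∸ ∣ X ∣) C k                   ∎
  where open ≡-Reasoning

-- Inclusion-exclusion for k-sets meeting two given sets.

Transversal : ∀ {n} → ℕ → Subset n → Subset n → Pred (Subset n) 0ℓ
Transversal k X Y A = (∣ A ∣ ≡ k × Nonempty (A ∩ X)) × Nonempty (A ∩ Y)

transversal? : ∀ {n} k (X Y : Subset n) → Decidable (Transversal k X Y)
transversal? k X Y = (size? k ∩? meets? X) ∩? meets? Y

-- The truncated subtraction is harmless: the subtrahend is at most the minuend.
count-transversal : ∀ {n} k (X Y : Subset n) →
  count (transversal? k X Y)
    ≡ (n C k + (n ∸ ∣ X ∪ Y ∣) C k) ∸ ((n ∸ ∣ X ∣) C k + (n ∸ ∣ Y ∣) C k)
count-transversal {n} k X Y = begin
  -- The identity is proved additively as `inclusion-exclusion`; the subtraction enters only here,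
  -- by cancelling `x + y`.
  t                                          ≡⟨ m+n∸n≡m t (x + y) ⟨
  (t + (x + y)) ∸ (x + y)                    ≡⟨ cong₂ _∸_ inclusion-exclusion
                                                  (cong₂ _+_ (count-disjoint k X) (count-disjoint k Y)) ⟩
  (n C k + (n ∸ ∣ X ∪ Y ∣) C k) ∸ ((n ∸ ∣ X ∣) C k + (n ∸ ∣ Y ∣) C k) ∎
  where
  open ≡-Reasoning
  open +-*-Solver
  K  = size? {n} k
  MX = meets? X
  MY = meets? Y
  t  = count (transversal? k X Y)
  w  = count ((K ∩? MX) ∩? ∁? MY)
  u  = count (K ∩? ∁? (meets? (X ∪ Y)))
  x  = count (K ∩? ∁? MX)
  y  = count (K ∩? ∁? MY)

  ∪-disjoint : ∀ {A : Subset n} → Empty (A ∩ X) → Empty (A ∩ Y) → Empty (A ∩ (X ∪ Y))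
  ∪-disjoint {A} dX dY (_ , x∈) with x∈p∩q⁻ A (X ∪ Y) x∈
  ... | x∈A , x∈X∪Y = [ (λ x∈X → dX (_ , x∈p∩q⁺ (x∈A , x∈X)))
                      , (λ x∈Y → dY (_ , x∈p∩q⁺ (x∈A , x∈Y))) ] (x∈p∪q⁻ X Y x∈X∪Y)

  disjoint-anti : ∀ {A Z W : Subset n} → Z ⊆ W → Empty (A ∩ W) → Empty (A ∩ Z)
  disjoint-anti {A} {Z} Z⊆W d (_ , x∈) with x∈p∩q⁻ A Z x∈
  ... | x∈A , x∈Z = d (_ , x∈p∩q⁺ (x∈A , Z⊆W x∈Z))

  -- The k-sets avoiding Y either meet X (`w`) or avoid both sets (`u`).
  avoids-Y : y ≡ w + u
  avoids-Y = trans (count-split (K ∩? ∁? MY) MX) (cong₂ _+_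
    (count-≐ _ ((K ∩? MX) ∩? ∁? MY)
      ((λ ((e , d) , m) → (e , m) , d) , (λ ((e , m) , d) → (e , d) , m)))
    (count-≐ _ (K ∩? ∁? (meets? (X ∪ Y)))
      ( (λ ((e , dY) , dX) → e , ∪-disjoint dX dY)
      , (λ (e , d) → (e , disjoint-anti (q⊆p∪q X Y) d) , disjoint-anti (p⊆p∪q Y) d))))

  -- Here `t + w` counts the k-sets meeting X, and adding `x` gives all k-sets; the sets avoiding
  -- both X and Y are counted in `x` and again in `u`.
  inclusion-exclusion : t + (x + y) ≡ n C k + (n ∸ ∣ X ∪ Y ∣) C k
  inclusion-exclusion = begin
    t + (x + y)          ≡⟨ cong (λ z → t + (x + z)) avoids-Y ⟩
    t + (x + (w + u))    ≡⟨ solve 4 (λ t x w u → t :+ (x :+ (w :+ u)) := ((t :+ w) :+ x) :+ u) refl t x w u ⟩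
    ((t + w) + x) + u    ≡⟨ cong (λ z → (z + x) + u) (count-split (K ∩? MX) MY) ⟨
    (count (K ∩? MX) + x) + u
                         ≡⟨ cong (_+ u) (count-split K MX) ⟨
    count K + u          ≡⟨ cong₂ _+_ (count-size k) (count-disjoint k (X ∪ Y)) ⟩
    n C k + (n ∸ ∣ X ∪ Y ∣) C k ∎

-- Cardinalities of the four families.

∈⇒meets-⁅⁆ : ∀ {n} {A : Subset n} {x} → x ∈ A → Nonempty (A ∩ ⁅ x ⁆)
∈⇒meets-⁅⁆ {x = x} x∈A = x , x∈p∩q⁺ (x∈A , x∈⁅x⁆ x)

meets-⁅⁆⇒∈ : ∀ {n} {A : Subset n} {x} → Nonempty (A ∩ ⁅ x ⁆) → x ∈ A
meets-⁅⁆⇒∈ {A = A} {x} (y , y∈) with x∈p∩q⁻ A ⁅ x ⁆ y∈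
... | y∈A , y∈⁅x⁆ = subst (_∈ A) (x∈⁅y⁆⇒x≡y x y∈⁅x⁆) y∈A

-- Accounts for the one exceptional set of `base` and of `𝒞ₐ`: since S fails P, it contributes
-- exactly one further member.
card-insert : ∀ {n} (𝒜 : Family n) {P : Pred (Subset n) 0ℓ} (P? : Decidable P) (S : Subset n) →
              Member 𝒜 ≐ (_≡ S) Unary.∪ P → ¬ P S → card 𝒜 ≡ suc (count P?)
card-insert 𝒜 P? S 𝒜≐ ¬PS = begin
  card 𝒜                    ≡⟨ count-≐ (member? 𝒜) (is? S ∪? P?) 𝒜≐ ⟩
  count (is? S ∪? P?)       ≡⟨ count-∪ (is? S) P? (λ { refl → ¬PS }) ⟩
  count (is? S) + count P?  ≡⟨ cong (_+ count P?) (count-≡ S) ⟩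
  suc (count P?)            ∎
  where open ≡-Reasoning

-- The leading `outside` says that both sets avoid the element 1, which is index `zero`. Hence {1} ∪
-- T has |T| + 1 elements, and the exceptional set does not meet {1}.
card-base : ∀ {n} k (S T : Subset n) →
  card (base k (outside ∷ S) (outside ∷ T))
    ≡ suc ((suc n C k + (n ∸ ∣ T ∣) C k) ∸ (n C k + (suc n ∸ ∣ T ∣) C k))
card-base {n} k S T = begin
  card (base k S′ T′)
    ≡⟨ card-insert (base k S′ T′) (transversal? k ⁅ zero ⁆ T′) S′ (to , from)
         (λ ((_ , m1) , _) → contradiction (meets-⁅⁆⇒∈ {A = S′} {zero} m1) λ ()) ⟩
  suc (count (transversal? k ⁅ zero ⁆ T′))
    ≡⟨ cong suc (count-transversal k ⁅ zero ⁆ T′) ⟩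
  suc ((suc n C k + (n ∸ ∣ ⊥ ∪ T ∣) C k) ∸ ((suc n ∸ ∣ ⁅ zero {n} ⁆ ∣) C k + (suc n ∸ ∣ T ∣) C k))
    ≡⟨ cong₂ (λ Z z → suc ((suc n C k + (n ∸ ∣ Z ∣) C k) ∸ ((suc n ∸ z) C k + (suc n ∸ ∣ T ∣) C k)))
             (∪-identityˡ T) (∣⁅x⁆∣≡1 {suc n} zero) ⟩
  suc ((suc n C k + (n ∸ ∣ T ∣) C k) ∸ (n C k + (suc n ∸ ∣ T ∣) C k)) ∎
  where
  open ≡-Reasoning
  S′ = outside ∷ S
  T′ = outside ∷ T

  to : Member (base k S′ T′) Unary.⊆ (_≡ S′) Unary.∪ Transversal k ⁅ zero ⁆ T′
  to (inj₁ A≡S)                            = inj₁ A≡S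
  to (inj₂ (e , (zero , refl , 1∈A) , mT)) = inj₂ ((e , ∈⇒meets-⁅⁆ 1∈A) , mT)

  from : (_≡ S′) Unary.∪ Transversal k ⁅ zero ⁆ T′ Unary.⊆ Member (base k S′ T′)
  from (inj₁ A≡S)             = inj₁ A≡S
  from (inj₂ ((e , m1) , mT)) = inj₂ (e , (zero , refl , meets-⁅⁆⇒∈ m1) , mT)

-- Lets the formula for |𝒜₀| be reused for |ℬ₀|, with the roles of a and b exchanged.
BasePair-sym : ∀ {n a b A₀ B₀} → BasePair n a b A₀ B₀ → BasePair n b a B₀ A₀
BasePair-sym {A₀ = A₀} {B₀} p = record
  { A₀⊆[2,n] = B₀⊆[2,n]
  ; ∣A₀∣≡a   = ∣B₀∣≡b
  ; B₀⊆[2,n] = A₀⊆[2,n]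
  ; ∣B₀∣≡b   = ∣A₀∣≡a
  ; A₀∩B₀≢∅  = subst Nonempty (∩-comm A₀ B₀) A₀∩B₀≢∅
  }
  where open BasePair p

-- The inclusions in [2,n] force both heads to be `outside`, and the common element rules out n = 0;
-- what is left depends on B₀ only through its size.
card-𝒜₀ : ∀ {n a b A₀ B₀} → BasePair n a b A₀ B₀ →
  card (base a A₀ B₀) ≡ suc ((n C a + (n ∸ suc b) C a) ∸ ((n ∸ 1) C a + (n ∸ b) C a))
card-𝒜₀ {A₀ = []}          {[]}          p = contradiction (proj₁ (BasePair.A₀∩B₀≢∅ p)) λ ()
card-𝒜₀ {A₀ = inside  ∷ _} {_}           p = contradiction (BasePair.A₀⊆[2,n] p here) λ ()
card-𝒜₀ {A₀ = outside ∷ _} {inside  ∷ _} p = contradiction (BasePair.B₀⊆[2,n] p here) λ ()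
card-𝒜₀ {suc n} {a} {A₀ = outside ∷ A} {outside ∷ B} p = trans (card-base a A B)
  (cong (λ b → suc ((suc n C a + (n ∸ b) C a) ∸ (n C a + (suc n ∸ b) C a))) (BasePair.∣B₀∣≡b p))

-- Meeting {1} and {2} is containing {1,2}. For a ≥ 2 the truncated difference is C(n-2,a-2) in
-- inclusion-exclusion form; the outer `suc` counts [3,a+2], which misses 1.
card-𝒞ₐ : ∀ {n} a → 2 ≤ n →
  card (𝒞ₐ n a) ≡ suc ((n C a + (n ∸ 2) C a) ∸ ((n ∸ 1) C a + (n ∸ 1) C a))
card-𝒞ₐ {suc (suc n)} a (s≤s (s≤s z≤n)) = begin
  card (𝒞ₐ n′ a)
    ≡⟨ card-insert (𝒞ₐ n′ a) (transversal? a ⁅1⁆ ⁅2⁆) [ 3 ⋯ a + 2 ]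
         (Sum.swap ∘ Sum.map₁ to , Sum.map₁ from ∘ Sum.swap)
         (λ ((_ , m1) , _) → contradiction (meets-⁅⁆⇒∈ {A = [ 3 ⋯ a + 2 ]} {zero} m1) λ ()) ⟩
  suc (count (transversal? a ⁅1⁆ ⁅2⁆))
    ≡⟨ cong suc (count-transversal a ⁅1⁆ ⁅2⁆) ⟩
  suc ((n′ C a + (n′ ∸ ∣ ⁅1⁆ ∪ ⁅2⁆ ∣) C a) ∸ ((n′ ∸ ∣ ⁅1⁆ ∣) C a + (n′ ∸ ∣ ⁅2⁆ ∣) C a))
    ≡⟨ cong₂ (λ y z → suc ((n′ C a + (n′ ∸ y) C a) ∸ z)) ∣⁅1⁆∪⁅2⁆∣≡2
         (cong₂ (λ y z → (n′ ∸ y) C a + (n′ ∸ z) C a) (∣⁅x⁆∣≡1 {n′} zero) (∣⁅x⁆∣≡1 {n′} (suc zero))) ⟩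
  suc ((n′ C a + n C a) ∸ (suc n C a + suc n C a)) ∎
  where
  open ≡-Reasoning
  n′ = suc (suc n)

  ⁅1⁆ ⁅2⁆ : Subset n′
  ⁅1⁆ = ⁅ zero ⁆
  ⁅2⁆ = ⁅ suc zero ⁆

  ∣⁅1⁆∪⁅2⁆∣≡2 : ∣ ⁅1⁆ ∪ ⁅2⁆ ∣ ≡ 2
  ∣⁅1⁆∪⁅2⁆∣≡2 = cong suc (trans (cong ∣_∣ (∪-identityˡ {suc n} ⁅ zero ⁆)) (∣⁅x⁆∣≡1 {suc n} zero))

  to : ∀ {A} → ∣ A ∣ ≡ a × [ 1 ⋯ 2 ] ⊆ A → Transversal a ⁅1⁆ ⁅2⁆ A
  to (e , 12⊆A) = (e , ∈⇒meets-⁅⁆ (12⊆A here)) , ∈⇒meets-⁅⁆ (12⊆A (there here))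

  [1⋯2]⊆ : ∀ {A : Subset n′} → zero ∈ A → suc zero ∈ A → [ 1 ⋯ 2 ] ⊆ A
  [1⋯2]⊆ 1∈A 2∈A {zero}        _                 = 1∈A
  [1⋯2]⊆ 1∈A 2∈A {suc zero}    _                 = 2∈A
  -- From the third index on, the label exceeds 2, so the tabulated entry computes to `outside`.
  [1⋯2]⊆ 1∈A 2∈A {suc (suc x)} (there (there x∈)) =
    contradiction (trans (sym (lookup∘tabulate _ x)) ([]=⇒lookup x∈)) λ ()

  from : ∀ {A} → Transversal a ⁅1⁆ ⁅2⁆ A → ∣ A ∣ ≡ a × [ 1 ⋯ 2 ] ⊆ A
  from ((e , m1) , m2) = e , [1⋯2]⊆ (meets-⁅⁆⇒∈ m1) (meets-⁅⁆⇒∈ m2)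

-- The choices of i and j are independent, so containing some pair {i,j} decouples into meeting each
-- of the two intervals.
𝒞ᵇ≐Transversal : ∀ {n} a b → Member (𝒞ᵇ n a b) ≐ Transversal b [ 1 ⋯ 2 ] [ 3 ⋯ a + 2 ]
𝒞ᵇ≐Transversal {n} a b = to , from
  where
  to : Member (𝒞ᵇ n a b) Unary.⊆ Transversal b [ 1 ⋯ 2 ] [ 3 ⋯ a + 2 ]
  to (e , i , j , i∈ , j∈ , ij⊆A) =
    (e , i , x∈p∩q⁺ (ij⊆A (p⊆p∪q _ (x∈⁅x⁆ i)) , i∈)) , j , x∈p∩q⁺ (ij⊆A (q⊆p∪q ⁅ i ⁆ _ (x∈⁅x⁆ j)) , j∈)

  from : Transversal b [ 1 ⋯ 2 ] [ 3 ⋯ a + 2 ] Unary.⊆ Member (𝒞ᵇ n a b)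
  from {A} ((e , i , i∈) , j , j∈) with x∈p∩q⁻ A _ i∈ | x∈p∩q⁻ A _ j∈
  ... | i∈A , i∈X | j∈A , j∈Y = e , i , j , i∈X , j∈Y , λ x∈ →
    [ (λ x∈i → subst (_∈ A) (sym (x∈⁅y⁆⇒x≡y i x∈i)) i∈A)
    , (λ x∈j → subst (_∈ A) (sym (x∈⁅y⁆⇒x≡y j x∈j)) j∈A)
    ] (x∈p∪q⁻ ⁅ i ⁆ ⁅ j ⁆ x∈)

-- The interval sizes stay symbolic because intervals are cut off at n; for n = 18 and a = 9 the
-- sets X, Y and X ∪ Y have 2, 9 and 11 elements.
card-𝒞ᵇ : ∀ n a b → let X = [_⋯_] {n} 1 2; Y = [_⋯_] {n} 3 (a + 2) in
  card (𝒞ᵇ n a b) ≡ (n C b + (n ∸ ∣ X ∪ Y ∣) C b) ∸ ((n ∸ ∣ X ∣) C b + (n ∸ ∣ Y ∣) C b)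
card-𝒞ᵇ n a b = trans
  (count-≐ (member? (𝒞ᵇ n a b)) (transversal? b [ 1 ⋯ 2 ] [ 3 ⋯ a + 2 ]) (𝒞ᵇ≐Transversal a b))
  (count-transversal b [ 1 ⋯ 2 ] [ 3 ⋯ a + 2 ])

-- Non-triviality and uniformity of the counterexample.

disjoint-members⇒¬Star : ∀ {n} {𝒜 : Family n} {A B} →
                         A ∈ᶠ 𝒜 → B ∈ᶠ 𝒜 → Empty (A ∩ B) → ¬ Star 𝒜
disjoint-members⇒¬Star A∈𝒜 B∈𝒜 A∩B≡∅ (x , x∈) = A∩B≡∅ (x , x∈p∩q⁺ (x∈ A∈𝒜 , x∈ B∈𝒜))

-- For a pair {i,j} inside B, a set containing {1,2} meets B in i, while the exceptional set [3,a+2]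
-- meets B in j.
𝒞-crossIntersecting : ∀ {n} a b → CrossIntersecting (𝒞ₐ n a) (𝒞ᵇ n a b)
𝒞-crossIntersecting a b (inj₁ (_ , 12⊆A)) (_ , i , j , i∈ , _ , ij⊆B) =
  i , x∈p∩q⁺ (12⊆A i∈ , ij⊆B (p⊆p∪q _ (x∈⁅x⁆ i)))
𝒞-crossIntersecting a b (inj₂ refl) (_ , i , j , _ , j∈ , ij⊆B) =
  j , x∈p∩q⁺ (j∈ , ij⊆B (q⊆p∪q ⁅ i ⁆ _ (x∈⁅x⁆ j)))

𝒞-nonTrivial : NonTrivialCrossIntersecting (𝒞ₐ 18 9) (𝒞ᵇ 18 9 3)
𝒞-nonTrivial =
    𝒞-crossIntersecting 9 3
  , disjoint-members⇒¬Star {𝒜 = 𝒞ₐ 18 9} {A} {B}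
      (inj₁ (refl , p⊆p∪q {p = [ 1 ⋯ 2 ]} [ 12 ⋯ 18 ])) (inj₂ refl) (from-no (nonempty? (A ∩ B)))
  , disjoint-members⇒¬Star {𝒜 = 𝒞ᵇ 18 9 3} {D} {E}
      (from-yes (member? (𝒞ᵇ 18 9 3) D)) (from-yes (member? (𝒞ᵇ 18 9 3) E))
      (from-no (nonempty? (D ∩ E)))
  where
  A B D E : Subset 18
  -- `A` completes {1,2} to nine elements using exactly the seven points beyond 11, hence is
  -- disjoint from the exceptional set `B`. `D` and `E` split 1 and 2 between them and take disjoint
  -- pairs from [3,11].
  A = [ 1 ⋯ 2 ] ∪ [ 12 ⋯ 18 ]
  B = [ 3 ⋯ 11 ]
  D = [ 1 ⋯ 1 ] ∪ [ 3 ⋯ 4 ]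
  E = [ 2 ⋯ 2 ] ∪ [ 5 ⋯ 6 ]

𝒞ₐ-uniform : Uniform 9 (𝒞ₐ 18 9)
𝒞ₐ-uniform (inj₁ (e , _)) = e
𝒞ₐ-uniform (inj₂ refl)    = refl

𝒞ᵇ-uniform : ∀ {n} a b → Uniform b (𝒞ᵇ n a b)
𝒞ᵇ-uniform a b = proj₁

-- Comparison of the two products and refutation of the bound.

𝒞-beats-base : ∀ A₀ B₀ → BasePair 18 9 3 A₀ B₀ →
  card (𝒞ₐ 18 9) * card (𝒞ᵇ 18 9 3) > card (base 9 A₀ B₀) * card (base 3 B₀ A₀)
𝒞-beats-base A₀ B₀ p =
  -- After rewriting by the closed formulas only binomial coefficients are evaluated, never the list
  -- of all 2^18 subsets.
  subst₂ _<_
    (sym (cong₂ _*_ (card-𝒜₀ p) (card-𝒜₀ (BasePair-sym p))))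
    (sym (cong₂ _*_ (card-𝒞ₐ 9 (from-yes (2 ≤? 18))) (card-𝒞ᵇ 18 9 3)))
    (from-yes (21308 * 109 <? 11441 * 207))

-- The bound quantifies over base pairs, so refuting it takes an actual one; these nested initial
-- segments of [2,18] share the element 2.
A₀ B₀ : Subset 18
A₀ = [ 2 ⋯ 10 ]
B₀ = [ 2 ⋯ 4 ]

basePair : BasePair 18 9 3 A₀ B₀
basePair = record
  { A₀⊆[2,n] = from-yes (A₀ ⊆? [ 2 ⋯ 18 ])
  ; ∣A₀∣≡a   = refl
  ; B₀⊆[2,n] = from-yes (B₀ ⊆? [ 2 ⋯ 18 ])
  ; ∣B₀∣≡b   = refl
  ; A₀∩B₀≢∅  = suc zero , there here
  }

-- Stated for variable families so that the type checker never evaluates a concrete cardinality.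
exceeds⇒¬bounded : ∀ {n} a b (A₀ B₀ : Subset n) (𝒜 ℬ : Family n) →
  card 𝒜 * card ℬ > card (base a A₀ B₀) * card (base b B₀ A₀) →
  ¬ (card 𝒜 * card ℬ ≤ card (base a A₀ B₀) * card (base b B₀ A₀))
exceeds⇒¬bounded a b A₀ B₀ 𝒜 ℬ = <⇒≱

mainTheorem3 : ¬ (∀ (n a b : ℕ) → n ≥ 2 * a → 2 * a ≥ 2 * b → 2 * b ≥ 4 →
    ∀ (A₀ B₀ : Subset n) → BasePair n a b A₀ B₀ →
    ∀ (𝒜 ℬ : Family n) → Uniform a 𝒜 → Uniform b ℬ →
    NonTrivialCrossIntersecting 𝒜 ℬ →
    card 𝒜 * card ℬ ≤ card (base a A₀ B₀) * card (base b B₀ A₀))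
    × (Uniform 9 (𝒞ₐ 18 9)
    × Uniform 3 (𝒞ᵇ 18 9 3)
    × NonTrivialCrossIntersecting (𝒞ₐ 18 9) (𝒞ᵇ 18 9 3)
    × (∀ (A₀ B₀ : Subset 18) → BasePair 18 9 3 A₀ B₀ →
    card (𝒞ₐ 18 9) * card (𝒞ᵇ 18 9 3)
    > card (base 9 A₀ B₀) * card (base 3 B₀ A₀)))
mainTheorem3 =
    (λ bound → exceeds⇒¬bounded 9 3 A₀ B₀ (𝒞ₐ 18 9) (𝒞ᵇ 18 9 3) (𝒞-beats-base A₀ B₀ basePair)
      -- The three inequalities are n ≥ 2a, 2a ≥ 2b and 2b ≥ 4; the first holds with equality.
      (bound 18 9 3 (from-yes (18 ≤? 18)) (from-yes (6 ≤? 18)) (from-yes (4 ≤? 6))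
        A₀ B₀ basePair (𝒞ₐ 18 9) (𝒞ᵇ 18 9 3)
        𝒞ₐ-uniform (𝒞ᵇ-uniform 9 3) 𝒞-nonTrivial))
  , 𝒞ₐ-uniform , 𝒞ᵇ-uniform 9 3 , 𝒞-nonTrivial , 𝒞-beats-base
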